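{- For every bridgeless cubic graph $G$, $scc(G)>\frac{4}{3}\cdot|E(G)|$ if and only if $G$ is frumious; otherwise (that is, if $G$ is not frumious) $scc(G)=\frac{4}{3}\cdot|E(G)|$.
   Context: Graphs may contain parallel edges but no loops; bridgeless means $2$-edge-connected. A cycle is an even subgraph (a subgraph all of whose degrees are even). A cycle cover of $G$ is a family $\mathcal{C}$ of cycles of $G$ such that every edge of $G$ is contained in at least one cycle of $\mathcal{C}$; its length is the sum of the numbers of edges of the cycles in $\mathcal{C}$. $scc(G)$ is the minimum length of a cycle cover of $G$. A multigraph is Class I if its chromatic index equals its maximum degree. For a perfect matching $M$ of $G$ and an integer $t\ge 0$, $G+tM$ is the multigraph obtained from $G$ by adding $t$ parallel edges to every edge of $M$. $l_M(G)$ is the minimum $t\ge 0$ such that $G+tM$ is Class I, and $l_M(G)=+\infty$ if no such $t$ exists. A bridgeless cubic graph $G$ is frumious if $l_M(G)=+\infty$ for all perfect matchings $M$ of $G$. -}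

module Defs where

open import Data.Nat.Base using (ℕ; zero; suc; _+_; _*_; _≤_; _<_)
open import Data.Nat.Divisibility using (_∣_)
open import Data.Nat.ListAction using (sum)
open import Data.Fin.Base using (Fin; zero; suc; splitAt; remainder)
open import Data.Fin.Properties using (_≟_)
open import Data.Fin.Subset using (Subset; inside; outside; _∈_; _∉_; _∩_; ∣_∣)
open import Data.List.Base using (List; map; allFin)
open import Data.List.Extrema.Nat using (max)
open import Data.List.Relation.Unary.All using (All)
open import Data.List.Relation.Unary.Any using (Any)
open import Data.Vec.Base using (tabulate; _∷_)
open import Data.Product.Base using (_×_; _,_; proj₁; proj₂; ∃-syntax)
open import Data.Sum.Base using (_⊎_; [_,_]′)
open import Function.Base using (_∘_)
open import Relation.Binary.PropositionalEquality using (_≡_; _≢_)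
open import Relation.Nullary using (¬_; Dec; does)
open import Relation.Nullary.Decidable using (_⊎-dec_)
open import Relation.Nullary.Construct.Add.Supremum using (_⁺; [_]; ⊤⁺)

IsMinimum : (ℕ → Set) → ℕ → Set
IsMinimum P n = P n × (∀ k → P k → n ≤ k)

-- Edges are undirected: the order of the two components of `ends e` is
-- never used.  Distinct edges may have the same ends.
record Multigraph : Set where
  field
    #V       : ℕ
    #E       : ℕ
    ends     : Fin #E → Fin #V × Fin #V
    loopless : ∀ e → proj₁ (ends e) ≢ proj₂ (ends e)

module _ (G : Multigraph) where
  open Multigraph G

  V E : Set
  V = Fin #V
  E = Fin #E

  EdgeSet : Set
  EdgeSet = Subset #E

  Incident : V → E → Set
  Incident v e = v ≡ proj₁ (ends e) ⊎ v ≡ proj₂ (ends e)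

  incident? : ∀ v e → Dec (Incident v e)
  incident? v e = (v ≟ proj₁ (ends e)) ⊎-dec (v ≟ proj₂ (ends e))

  star : V → EdgeSet
  star v = tabulate (λ e → does (incident? v e))

  degreeIn : EdgeSet → V → ℕ
  degreeIn S v = ∣ S ∩ star v ∣

  degree : V → ℕ
  degree v = ∣ star v ∣

  maxDegree : ℕ
  maxDegree = max 0 (map degree (allFin #V))

  Cubic : Set
  Cubic = ∀ v → degree v ≡ 3

  -- Walks in the spanning subgraph G − F.
  data Walk (F : EdgeSet) : V → V → Set where
    stop : ∀ {u} → Walk F u u
    step : ∀ {u v w} e → e ∉ F → Incident u e → Incident v e →
           Walk F v w → Walk F u w

  -- 2-edge-connected: more than one vertex, and G − F is connected
  -- whenever F consists of fewer than two edges.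
  Bridgeless : Set
  Bridgeless = 1 < #V × (∀ F → ∣ F ∣ < 2 → ∀ u v → Walk F u v)

  -- "Cycle" means even subgraph, given by its edge set; it may be
  -- disconnected or empty.
  IsCycle : EdgeSet → Set
  IsCycle C = ∀ v → 2 ∣ degreeIn C v

  -- A family of cycles is a list, so members may be repeated.
  IsCycleCover : List EdgeSet → Set
  IsCycleCover 𝒞 = All IsCycle 𝒞 × (∀ e → Any (e ∈_) 𝒞)

  coverLength : List EdgeSet → ℕ
  coverLength 𝒞 = sum (map ∣_∣ 𝒞)

  -- `IsScc s` says scc(G) = s.
  IsScc : ℕ → Set
  IsScc = IsMinimum (λ l → ∃[ 𝒞 ] (IsCycleCover 𝒞 × coverLength 𝒞 ≡ l))

  IsPerfectMatching : EdgeSet → Set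
  IsPerfectMatching M = ∀ v → degreeIn M v ≡ 1

  IsProperEdgeColouring : ∀ {k} → (E → Fin k) → Set
  IsProperEdgeColouring c =
    ∀ v e f → Incident v e → Incident v f → e ≢ f → c e ≢ c f

  EdgeColourable : ℕ → Set
  EdgeColourable k = ∃[ c ] IsProperEdgeColouring {k} c

  IsChromaticIndex : ℕ → Set
  IsChromaticIndex = IsMinimum EdgeColourable

  ClassI : Set
  ClassI = IsChromaticIndex maxDegree

-- Lists the members of a subset in increasing order.
nth : ∀ {m} (S : Subset m) → Fin ∣ S ∣ → Fin m
nth (inside  ∷ S) zero    = zero
nth (inside  ∷ S) (suc i) = suc (nth S i)
nth (outside ∷ S) i       = suc (nth S i)

-- G + tM.  The first #E edges are those of G; the remaining t * ∣ M ∣ form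
-- t blocks, each containing one parallel copy of every edge of M.
addCopies : (G : Multigraph) → ℕ → EdgeSet G → Multigraph
addCopies G t M = record
  { #V       = #V
  ; #E       = #E + t * ∣ M ∣
  ; ends     = ends ∘ original
  ; loopless = loopless ∘ original
  }
  where
  open Multigraph G
  original : Fin (#E + t * ∣ M ∣) → Fin #E
  original e = [ (λ e → e) , (λ j → nth M (remainder {t} ∣ M ∣ j)) ]′ (splitAt #E e)

-- `Is-l G M x` says l_M(G) = x, where ⊤⁺ is +∞.
Is-l : (G : Multigraph) → EdgeSet G → ℕ ⁺ → Set
Is-l G M [ t ] = IsMinimum (λ s → ClassI (addCopies G s M)) t
Is-l G M ⊤⁺    = ¬ (∃[ t ] ClassI (addCopies G t M))

Frumious : Multigraph → Set
Frumious G = ∀ M → IsPerfectMatching G M → Is-l G M ⊤⁺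

-- In a cubic graph the members of a cycle cover meet each vertex an even number of times, at
-- least 3, hence at least 4, in total; summing over the vertices, the length is at least 4|E|/3.
-- If equality holds, the doubly covered edges form a perfect matching M, and each M △ Cᵢ is a
-- perfect matching too; for 3 + t cycles these use every edge of M exactly 1 + t times and every
-- other edge once, so they are the colour classes of a (3 + t)-edge-colouring of G + tM.
-- Conversely, if Nᵢ are the traces in G of the colour classes of G + tM, then the M △ Nᵢ form a
-- cycle cover of length |E| + |M| = 4|E|/3.

module Submission where

open import Defs
open import Data.Bool.Base using (Bool; true; false; _∧_; _xor_)
open import Data.Fin.Base
  using (Fin; zero; suc; splitAt; join; remainder; quotient; combine; quotRem; fromℕ<; toℕ)
open import Data.Fin.Properties
  using (_≟_; all?; suc-injective; toℕ<n; toℕ-injective; fromℕ<-injective; join-splitAt; combine-remQuot)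
open import Data.Fin.Subset using (Subset; inside; outside; _∈_; _∩_; ∣_∣; ⊥; ⁅_⁆)
open import Data.Fin.Subset.Properties
  using (anySubset?; _∈?_; ∣⊥∣≡0; ∣⁅x⁆∣≡1; x∈⁅x⁆; x∈⁅y⁆⇒x≡y)
open import Data.Integer.Base as ℤ using ()
import Data.Integer.Properties as ℤP
open import Data.List.Base as List using (List; []; _∷_; map)
open import Data.List.Extrema.Nat using (max; max≤v⁺; v≤max⁺)
open import Data.List.Membership.Propositional.Properties using (∈-lookup)
open import Data.List.Properties using (filter-accept; filter-reject)
open import Data.List.Relation.Unary.All as All using (All; []; _∷_)
import Data.List.Relation.Unary.All.Properties as AllP
open import Data.List.Relation.Unary.Any as Any using (Any; here; there)
import Data.List.Relation.Unary.Any.Properties as AnyP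
open import Data.Nat.Base using (ℕ; zero; suc; _+_; _*_; _∸_; _≤_; _<_; _<ᵇ_; z≤n; s≤s)
open import Data.Nat.Divisibility using (_∣_; _∣?_; divides; ∣m∣n⇒∣m+n; ∣m+n∣m⇒∣n; m∣m*n; _∣0)
import Data.Nat.ListAction as ListAction
open import Data.Nat.Properties hiding (suc-injective) renaming (_≟_ to _≟ℕ_)
open import Data.Nat.Solver using (module +-*-Solver)
open import Data.Product.Base using (_×_; _,_; proj₁; proj₂; ∃-syntax; map₂)
import Data.Rational.Unnormalised.Base as ℚᵘ
open import Data.Sum.Base as Sum using (_⊎_; inj₁; inj₂; [_,_]′)
open import Data.Vec.Base using (lookup; tabulate; zipWith; _∷_; [])
open import Data.Vec.Properties
  using (lookup∘tabulate; lookup-zipWith; lookup-replicate; lookup⇒[]=; []=⇒lookup)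
open import Function.Base using (_∘_; id)
open import Function.Bundles using (_⇔_; mk⇔)
open import Relation.Binary.PropositionalEquality
open import Relation.Nullary using (¬_; Dec; yes; no; does; contradiction)
open import Relation.Nullary.Decidable using (map′; dec-true; _×-dec_; _⊎-dec_)
open import Relation.Unary using (Decidable)

open import Algebra.Properties.Semiring.Sum +-*-semiring
  using (sum; sum-syntax; sum-cong-≗; ∑-distrib-+; ∑-comm; *-distribˡ-sum; *-distribʳ-sum)

-- With `M` fixed, `S ↦ M △ S` is an involution, so a single counting identity serves both
-- directions: an edge of `M` lies in exactly 2 of `3 + t` sets iff it lies in exactly `1 + t` of
-- their symmetric differences with `M`. `Factorisation` is the common middle ground and does not
-- mention parallel copies. The number `3 + t` is forced: `G + tM` is `(3 + t)`-regular, so in a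
-- Class I colouring every colour occurs at every vertex. Since `t` is free, a cover of any size can
-- be used; an empty cycle becomes the colour class `M` itself. The argument is constructive, and
-- this has two effects. Moreover, a graph that is not frumious comes without a matching as witness,
-- so equality is obtained by refuting the strict inequality.

private
  variable
    n : ℕ

-- Finite sums and 0/1 indicators

∑-const : ∀ n c → ∑[ i < n ] c ≡ n * c
∑-const zero    c = refl
∑-const (suc n) c = cong (c +_) (∑-const n c)

∑-mono : {f g : Fin n → ℕ} → (∀ i → f i ≤ g i) → sum f ≤ sum g
∑-mono {zero}  f≤g = z≤n
∑-mono {suc n} f≤g = +-mono-≤ (f≤g zero) (∑-mono (f≤g ∘ suc))

-- One strict term would make the totals differ. This turns global counts into local equalities
-- three times: for the loads of the vertices, for the degrees of the cycles compared with `M`, and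
-- for the colours at a vertex.
∑-mono-tight : {f g : Fin n → ℕ} → (∀ i → f i ≤ g i) → sum g ≤ sum f → ∀ i → f i ≡ g i
∑-mono-tight {suc n} {f} {g} f≤g ∑g≤∑f = λ
  { zero    → f₀≡g₀
  ; (suc i) → ∑-mono-tight (f≤g ∘ suc)
      (+-cancelˡ-≤ (g zero) _ _ (subst (λ x → g zero + sum (g ∘ suc) ≤ x + sum (f ∘ suc)) f₀≡g₀ ∑g≤∑f)) i }
  where
  f₀≡g₀ : f zero ≡ g zero
  f₀≡g₀ = ≤-antisym (f≤g zero) (+-cancelʳ-≤ (sum (g ∘ suc)) _ _
            (≤-trans ∑g≤∑f (+-monoʳ-≤ (f zero) (∑-mono (f≤g ∘ suc)))))

term≤∑ : (f : Fin n → ℕ) → ∀ i → f i ≤ sum f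
term≤∑ f zero    = m≤m+n _ _
term≤∑ f (suc i) = ≤-trans (term≤∑ (f ∘ suc) i) (m≤n+m _ _)

∑-positive : (f : Fin n → ℕ) → 1 ≤ sum f → ∃[ i ] 1 ≤ f i
∑-positive {suc n} f 1≤∑ with f zero in eq
... | suc _ = zero , subst (1 ≤_) (sym eq) (s≤s z≤n)
... | zero with i , p ← ∑-positive (f ∘ suc) 1≤∑ = suc i , p

∑-zero : (f : Fin n → ℕ) → (∀ i → f i ≡ 0) → sum f ≡ 0
∑-zero {n} f f≡0 = trans (sum-cong-≗ f≡0) (trans (∑-const n 0) (*-zeroʳ n))

𝟙 : Bool → ℕ
𝟙 true  = 1
𝟙 false = 0

𝟙≤1 : ∀ b → 𝟙 b ≤ 1
𝟙≤1 true  = ≤-refl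
𝟙≤1 false = z≤n

𝟙≥1⇒true : ∀ {b} → 1 ≤ 𝟙 b → b ≡ true
𝟙≥1⇒true {true} _ = refl

𝟙-∧ : ∀ a b → 𝟙 (a ∧ b) ≡ 𝟙 a * 𝟙 b
𝟙-∧ true  true  = refl
𝟙-∧ true  false = refl
𝟙-∧ false b     = refl

∑𝟙≤1 : (p : Fin n → Bool) → (∀ i j → p i ≡ true → p j ≡ true → i ≡ j) →
       ∑[ i < n ] 𝟙 (p i) ≤ 1
∑𝟙≤1 {zero}  p unique = z≤n
∑𝟙≤1 {suc n} p unique with p zero in eq
... | false = ∑𝟙≤1 (p ∘ suc) λ i j pi pj → suc-injective (unique (suc i) (suc j) pi pj)
... | true  = s≤s (≤-reflexive (∑-zero (𝟙 ∘ p ∘ suc) rest))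
  where
  rest : ∀ i → 𝟙 (p (suc i)) ≡ 0
  rest i with p (suc i) in eq′
  ... | false = refl
  ... | true  with () ← unique zero (suc i) eq eq′

∑𝟙≤1⇒unique : (p : Fin n → Bool) → ∑[ i < n ] 𝟙 (p i) ≤ 1 →
              ∀ i j → p i ≡ true → p j ≡ true → i ≡ j
∑𝟙≤1⇒unique p ∑≤1 zero    zero    pi pj = refl
∑𝟙≤1⇒unique p ∑≤1 zero    (suc j) pi pj = contradiction
  (≤-trans (≤-reflexive (sym (cong₂ _+_ (cong 𝟙 pi) (cong 𝟙 pj))))
    (≤-trans (+-monoʳ-≤ (𝟙 (p zero)) (term≤∑ (𝟙 ∘ p ∘ suc) j)) ∑≤1)) λ { (s≤s ()) }
∑𝟙≤1⇒unique p ∑≤1 (suc i) zero    pi pj = sym (∑𝟙≤1⇒unique p ∑≤1 zero (suc i) pj pi)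
∑𝟙≤1⇒unique p ∑≤1 (suc i) (suc j) pi pj =
  cong suc (∑𝟙≤1⇒unique (p ∘ suc) (≤-trans (m≤n+m _ _) ∑≤1) i j pi pj)

∑-δ : (j : Fin n) (f : Fin n → ℕ) → ∑[ i < n ] (𝟙 (does (i ≟ j)) * f i) ≡ f j
∑-δ {suc n} zero f = trans
  (cong₂ _+_ (+-identityʳ (f zero)) (∑-zero {n} (λ i → 𝟙 (does (suc i ≟ zero {n})) * f (suc i)) (λ _ → refl)))
  (+-identityʳ (f zero))
∑-δ {suc n} (suc j) f = ∑-δ j (f ∘ suc)

∑-δ₁ : (j : Fin n) → ∑[ i < n ] 𝟙 (does (i ≟ j)) ≡ 1
∑-δ₁ j = trans (sum-cong-≗ (λ i → sym (*-identityʳ (𝟙 (does (i ≟ j)))))) (∑-δ j (λ _ → 1))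

does-true : ∀ {a} {A : Set a} (A? : Dec A) → does A? ≡ true → A
does-true (yes a) _ = a

∑-splitAt : ∀ m {n} (f : Fin m ⊎ Fin n → ℕ) →
            ∑[ i < m + n ] f (splitAt m i) ≡ ∑[ i < m ] f (inj₁ i) + ∑[ j < n ] f (inj₂ j)
∑-splitAt zero    f = refl
∑-splitAt (suc m) f = trans (cong (f (inj₁ zero) +_) (∑-splitAt m (f ∘ Sum.map suc id)))
                            (sym (+-assoc (f (inj₁ zero)) _ _))

∑-remainder : ∀ t {n} (f : Fin n → ℕ) → ∑[ j < t * n ] f (remainder {t} n j) ≡ t * sum f
∑-remainder zero        f = refl
∑-remainder (suc t) {n} f = begin
  ∑[ j < n + t * n ] f (remainder {suc t} n j)  ≡⟨ sum-cong-≗ (λ j → by-block (splitAt n j)) ⟩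
  ∑[ j < n + t * n ] g (splitAt n j)            ≡⟨ ∑-splitAt n g ⟩
  sum f + ∑[ j < t * n ] f (remainder {t} n j)  ≡⟨ cong (sum f +_) (∑-remainder t f) ⟩
  sum f + t * sum f                             ∎
  where
  open ≡-Reasoning
  g : Fin n ⊎ Fin (t * n) → ℕ
  g = [ f , f ∘ remainder {t} n ]′
  by-block : ∀ s → f (proj₁ ([ (_, zero) , map₂ suc ∘ quotRem {t} n ]′ s)) ≡ g s
  by-block (inj₁ _) = refl
  by-block (inj₂ _) = refl

-- Characteristic functions and symmetric differences

χ : Subset n → Fin n → ℕ
χ S i = 𝟙 (lookup S i)

∣∣≡∑χ : (S : Subset n) → ∣ S ∣ ≡ ∑[ i < n ] χ S i
∣∣≡∑χ []            = refl
∣∣≡∑χ (inside  ∷ S) = cong suc (∣∣≡∑χ S)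
∣∣≡∑χ (outside ∷ S) = ∣∣≡∑χ S

∑-nth : (S : Subset n) (f : Fin n → ℕ) → ∑[ i < ∣ S ∣ ] f (nth S i) ≡ ∑[ j < n ] (χ S j * f j)
∑-nth []            f = refl
∑-nth (inside  ∷ S) f = cong₂ _+_ (sym (+-identityʳ (f zero))) (∑-nth S (f ∘ suc))
∑-nth (outside ∷ S) f = ∑-nth S (f ∘ suc)

nth-injective : (S : Subset n) → ∀ {i j} → nth S i ≡ nth S j → i ≡ j
nth-injective (inside  ∷ S) {zero}  {zero}  _  = refl
nth-injective (inside  ∷ S) {suc i} {suc j} eq = cong suc (nth-injective S (suc-injective eq))
nth-injective (outside ∷ S)                 eq = nth-injective S (suc-injective eq)

lookup-nth : (S : Subset n) → ∀ i → lookup S (nth S i) ≡ true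
lookup-nth (inside  ∷ S) zero    = refl
lookup-nth (inside  ∷ S) (suc i) = lookup-nth S i
lookup-nth (outside ∷ S) i       = lookup-nth S i

_△_ : Subset n → Subset n → Subset n
_△_ = zipWith _xor_

χ-∩ : (S T : Subset n) → ∀ i → χ (S ∩ T) i ≡ χ S i * χ T i
χ-∩ S T i = trans (cong 𝟙 (lookup-zipWith _∧_ i S T)) (𝟙-∧ (lookup S i) (lookup T i))

-- Writing the overlap on the left avoids subtraction in `ℕ`; since that term is even, parity
-- statements about `S △ T` follow by cancelling it.
χ-△ : (S T : Subset n) → ∀ i → χ (S △ T) i + 2 * χ (S ∩ T) i ≡ χ S i + χ T i
χ-△ S T i rewrite lookup-zipWith _xor_ i S T | lookup-zipWith _∧_ i S T
  with lookup S i | lookup T i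
... | true  | true  = refl
... | true  | false = refl
... | false | true  = refl
... | false | false = refl

χ-idem : (S : Subset n) → ∀ i → χ S i * χ S i ≡ χ S i
χ-idem S i with lookup S i
... | true  = refl
... | false = refl

-- Applied with `S` the matching, and with `T` first a tight cover and later the factors: it
-- converts multiplicities in either direction.
∑-△ : ∀ {k} (S : Subset n) (T : Fin k → Subset n) → ∀ e →
      ∑[ i < k ] χ (S △ T i) e + 2 * (χ S e * ∑[ i < k ] χ (T i) e) ≡ k * χ S e + ∑[ i < k ] χ (T i) e
∑-△ {k = k} S T e = begin
  ∑[ i < k ] χ (S △ T i) e + 2 * (χ S e * ∑[ i < k ] χ (T i) e)
    ≡⟨ cong (λ x → ∑[ i < k ] χ (S △ T i) e + 2 * x) (*-distribˡ-sum (χ S e) (λ i → χ (T i) e)) ⟩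
  ∑[ i < k ] χ (S △ T i) e + 2 * ∑[ i < k ] (χ S e * χ (T i) e)
    ≡⟨ cong (λ x → ∑[ i < k ] χ (S △ T i) e + 2 * x) (sum-cong-≗ (λ i → sym (χ-∩ S (T i) e))) ⟩
  ∑[ i < k ] χ (S △ T i) e + 2 * ∑[ i < k ] χ (S ∩ T i) e
    ≡⟨ cong (∑[ i < k ] χ (S △ T i) e +_) (*-distribˡ-sum 2 (λ i → χ (S ∩ T i) e)) ⟩
  ∑[ i < k ] χ (S △ T i) e + ∑[ i < k ] (2 * χ (S ∩ T i) e)
    ≡⟨ sym (∑-distrib-+ (λ i → χ (S △ T i) e) (λ i → 2 * χ (S ∩ T i) e)) ⟩
  ∑[ i < k ] (χ (S △ T i) e + 2 * χ (S ∩ T i) e)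
    ≡⟨ sum-cong-≗ (λ i → χ-△ S (T i) e) ⟩
  ∑[ i < k ] (χ S e + χ (T i) e)
    ≡⟨ ∑-distrib-+ (λ _ → χ S e) (λ i → χ (T i) e) ⟩
  ∑[ i < k ] χ S e + ∑[ i < k ] χ (T i) e
    ≡⟨ cong (_+ ∑[ i < k ] χ (T i) e) (∑-const k (χ S e)) ⟩
  k * χ S e + ∑[ i < k ] χ (T i) e ∎
  where open ≡-Reasoning

2∣∑ : (f : Fin n → ℕ) → (∀ i → 2 ∣ f i) → 2 ∣ sum f
2∣∑ {zero}  f even = 2 ∣0
2∣∑ {suc n} f even = ∣m∣n⇒∣m+n (even zero) (2∣∑ (f ∘ suc) (even ∘ suc))

even∧≥3⇒≥4 : 2 ∣ n → 3 ≤ n → 4 ≤ n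
even∧≥3⇒≥4 (divides (suc (suc q)) refl) _ = s≤s (s≤s (s≤s (s≤s z≤n)))
even∧≥3⇒≥4 (divides 1 refl) (s≤s (s≤s ()))

even∧≥d⇒≥2d : ∀ d → 2 ∣ n → d ≤ 1 → d ≤ n → 2 * d ≤ n
even∧≥d⇒≥2d zero          _                          _       _ = z≤n
even∧≥d⇒≥2d 1             (divides (suc q) refl)     _       _ = s≤s (s≤s z≤n)
even∧≥d⇒≥2d (suc (suc _)) _                          (s≤s ()) _

𝟙-positive : ∀ {x} → x ≤ 1 → 𝟙 (0 <ᵇ x) ≡ x
𝟙-positive z≤n       = refl
𝟙-positive (s≤s z≤n) = refl

-- Degrees as sums over edges, and double counting

module Degrees (G : Multigraph) where
  open Multigraph G

  inc : V G → E G → ℕ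
  inc v e = 𝟙 (does (incident? G v e))

  -- Looplessness excludes the one case in which the sides differ, 1 against 2.
  inc-ends : ∀ v e → inc v e ≡ 𝟙 (does (v ≟ proj₁ (ends e))) + 𝟙 (does (v ≟ proj₂ (ends e)))
  inc-ends v e with v ≟ proj₁ (ends e) | v ≟ proj₂ (ends e)
  ... | yes p | yes q = contradiction (trans (sym p) q) (loopless e)
  ... | yes _ | no  _ = refl
  ... | no  _ | yes _ = refl
  ... | no  _ | no  _ = refl

  inc-true : ∀ {v e} → Incident G v e → inc v e ≡ 1
  inc-true {v} {e} i = cong 𝟙 (dec-true (incident? G v e) i)

  ∑-inc : ∀ e → ∑[ v < #V ] inc v e ≡ 2
  ∑-inc e = trans (sum-cong-≗ (λ v → inc-ends v e))
    (trans (∑-distrib-+ (λ v → 𝟙 (does (v ≟ proj₁ (ends e)))) (λ v → 𝟙 (does (v ≟ proj₂ (ends e)))))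
      (cong₂ _+_ (∑-δ₁ (proj₁ (ends e))) (∑-δ₁ (proj₂ (ends e)))))

  χ-star : ∀ v e → χ (star G v) e ≡ inc v e
  χ-star v e = cong 𝟙 (lookup∘tabulate (λ e → does (incident? G v e)) e)

  degree≡∑ : ∀ v → degree G v ≡ ∑[ e < #E ] inc v e
  degree≡∑ v = trans (∣∣≡∑χ (star G v)) (sum-cong-≗ (χ-star v))

  degreeIn≡∑ : ∀ S v → degreeIn G S v ≡ ∑[ e < #E ] (χ S e * inc v e)
  degreeIn≡∑ S v = trans (∣∣≡∑χ (S ∩ star G v))
    (sum-cong-≗ (λ e → trans (χ-∩ S (star G v) e) (cong (χ S e *_) (χ-star v e))))

  handshake : (w : E G → ℕ) → ∑[ v < #V ] ∑[ e < #E ] (w e * inc v e) ≡ 2 * sum w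
  handshake w = begin
    ∑[ v < #V ] ∑[ e < #E ] (w e * inc v e)  ≡⟨ ∑-comm (λ v e → w e * inc v e) ⟩
    ∑[ e < #E ] ∑[ v < #V ] (w e * inc v e)  ≡⟨ sum-cong-≗ (λ e → sym (*-distribˡ-sum (w e) (λ v → inc v e))) ⟩
    ∑[ e < #E ] (w e * ∑[ v < #V ] inc v e)  ≡⟨ sum-cong-≗ (λ e → cong (w e *_) (∑-inc e)) ⟩
    ∑[ e < #E ] (w e * 2)                    ≡⟨ sym (*-distribʳ-sum 2 w) ⟩
    sum w * 2                                ≡⟨ *-comm (sum w) 2 ⟩
    2 * sum w                                ∎
    where open ≡-Reasoning

  degreeIn-handshake : ∀ S → ∑[ v < #V ] degreeIn G S v ≡ 2 * ∣ S ∣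
  degreeIn-handshake S = trans (sum-cong-≗ (degreeIn≡∑ S))
    (trans (handshake (χ S)) (cong (2 *_) (sym (∣∣≡∑χ S))))

  degree-handshake : ∑[ v < #V ] degree G v ≡ 2 * #E
  degree-handshake = begin
    ∑[ v < #V ] degree G v                  ≡⟨ sum-cong-≗ degree≡∑ ⟩
    ∑[ v < #V ] ∑[ e < #E ] inc v e         ≡⟨ sum-cong-≗ (λ v → sum-cong-≗ (λ e → sym (*-identityˡ (inc v e)))) ⟩
    ∑[ v < #V ] ∑[ e < #E ] (1 * inc v e)   ≡⟨ handshake (λ _ → 1) ⟩
    2 * ∑[ e < #E ] 1                       ≡⟨ cong (2 *_) (trans (∑-const #E 1) (*-identityʳ #E)) ⟩
    2 * #E                                  ∎
    where open ≡-Reasoning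

  ∑-degreeIn : ∀ {k} (C : Fin k → EdgeSet G) v →
               ∑[ i < k ] degreeIn G (C i) v ≡ ∑[ e < #E ] (∑[ i < k ] χ (C i) e * inc v e)
  ∑-degreeIn {k} C v = begin
    ∑[ i < k ] degreeIn G (C i) v                  ≡⟨ sum-cong-≗ (λ i → degreeIn≡∑ (C i) v) ⟩
    ∑[ i < k ] ∑[ e < #E ] (χ (C i) e * inc v e)   ≡⟨ ∑-comm (λ i e → χ (C i) e * inc v e) ⟩
    ∑[ e < #E ] ∑[ i < k ] (χ (C i) e * inc v e)   ≡⟨ sum-cong-≗ (λ e → sym (*-distribʳ-sum (inc v e) (λ i → χ (C i) e))) ⟩
    ∑[ e < #E ] (∑[ i < k ] χ (C i) e * inc v e)   ∎
    where open ≡-Reasoning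

  degreeIn-△ : ∀ S T v →
    degreeIn G (S △ T) v + 2 * degreeIn G (S ∩ T) v ≡ degreeIn G S v + degreeIn G T v
  degreeIn-△ S T v = begin
    degreeIn G (S △ T) v + 2 * degreeIn G (S ∩ T) v
      ≡⟨ cong₂ (λ x y → x + 2 * y) (degreeIn≡∑ (S △ T) v) (degreeIn≡∑ (S ∩ T) v) ⟩
    sum (d (S △ T)) + 2 * sum (d (S ∩ T))
      ≡⟨ cong (sum (d (S △ T)) +_) (*-distribˡ-sum 2 (d (S ∩ T))) ⟩
    sum (d (S △ T)) + ∑[ e < #E ] (2 * d (S ∩ T) e)
      ≡⟨ sym (∑-distrib-+ (d (S △ T)) (λ e → 2 * d (S ∩ T) e)) ⟩
    ∑[ e < #E ] (d (S △ T) e + 2 * d (S ∩ T) e)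
      ≡⟨ sum-cong-≗ pointwise ⟩
    ∑[ e < #E ] (d S e + d T e)
      ≡⟨ ∑-distrib-+ (d S) (d T) ⟩
    sum (d S) + sum (d T)
      ≡⟨ sym (cong₂ _+_ (degreeIn≡∑ S v) (degreeIn≡∑ T v)) ⟩
    degreeIn G S v + degreeIn G T v ∎
    where
    open ≡-Reasoning
    d : EdgeSet G → E G → ℕ
    d S e = χ S e * inc v e
    pointwise : ∀ e → d (S △ T) e + 2 * d (S ∩ T) e ≡ d S e + d T e
    pointwise e = begin
      χ (S △ T) e * inc v e + 2 * (χ (S ∩ T) e * inc v e)
        ≡⟨ cong (χ (S △ T) e * inc v e +_) (sym (*-assoc 2 (χ (S ∩ T) e) (inc v e))) ⟩
      χ (S △ T) e * inc v e + 2 * χ (S ∩ T) e * inc v e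
        ≡⟨ sym (*-distribʳ-+ (inc v e) (χ (S △ T) e) _) ⟩
      (χ (S △ T) e + 2 * χ (S ∩ T) e) * inc v e
        ≡⟨ cong (_* inc v e) (χ-△ S T e) ⟩
      (χ S e + χ T e) * inc v e
        ≡⟨ *-distribʳ-+ (inc v e) (χ S e) (χ T e) ⟩
      d S e + d T e ∎

  degreeIn-∩≤ˡ : ∀ S T v → degreeIn G (S ∩ T) v ≤ degreeIn G S v
  degreeIn-∩≤ˡ S T v = subst₂ _≤_ (sym (degreeIn≡∑ (S ∩ T) v)) (sym (degreeIn≡∑ S v))
    (∑-mono λ e → *-monoˡ-≤ (inc v e) (≤-trans (≤-reflexive (χ-∩ S T e))
      (≤-trans (*-monoʳ-≤ (χ S e) (𝟙≤1 (lookup T e))) (≤-reflexive (*-identityʳ (χ S e))))))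

  degreeIn-∩≤ʳ : ∀ S T v → degreeIn G (S ∩ T) v ≤ degreeIn G T v
  degreeIn-∩≤ʳ S T v = subst₂ _≤_ (sym (degreeIn≡∑ (S ∩ T) v)) (sym (degreeIn≡∑ T v))
    (∑-mono λ e → *-monoˡ-≤ (inc v e) (≤-trans (≤-reflexive (χ-∩ S T e))
      (≤-trans (*-monoˡ-≤ (χ T e) (𝟙≤1 (lookup S e))) (≤-reflexive (*-identityˡ (χ T e))))))

-- The traces in G of the colour classes of a (3 + t)-edge-colouring of G + tM.
record Factorisation (G : Multigraph) (t : ℕ) (M : EdgeSet G) : Set where
  field
    factor   : Fin (3 + t) → EdgeSet G
    perfect  : ∀ i → IsPerfectMatching G (factor i)
    exact    : ∀ e → ∑[ i < 3 + t ] χ (factor i) e ≡ 1 + t * χ M e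

-- Tight cycle covers and factorisations of a cubic graph

module CubicGraph (G : Multigraph) (cubic : Cubic G) where
  open Multigraph G
  open Degrees G

  3V≡2E : #V * 3 ≡ 2 * #E
  3V≡2E = trans (trans (sym (∑-const #V 3)) (sum-cong-≗ (sym ∘ cubic))) degree-handshake

  module Family {k} (C : Fin k → EdgeSet G) (even : ∀ i → IsCycle G (C i))
                (covers : ∀ e → 1 ≤ ∑[ i < k ] χ (C i) e) where

    size : ℕ
    size = ∑[ i < k ] ∣ C i ∣

    mult : E G → ℕ
    mult e = ∑[ i < k ] χ (C i) e

    load : V G → ℕ
    load v = ∑[ i < k ] degreeIn G (C i) v

    4≤load : ∀ v → 4 ≤ load v
    4≤load v = even∧≥3⇒≥4 (2∣∑ (λ i → degreeIn G (C i) v) (λ i → even i v)) (begin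
      3                                     ≡⟨ sym (cubic v) ⟩
      degree G v                            ≡⟨ degree≡∑ v ⟩
      ∑[ e < #E ] inc v e                   ≤⟨ ∑-mono (λ e → ≤-trans (≤-reflexive (sym (*-identityˡ (inc v e)))) (*-monoˡ-≤ (inc v e) (covers e))) ⟩
      ∑[ e < #E ] (mult e * inc v e)        ≡⟨ sym (∑-degreeIn C v) ⟩
      load v                                ∎)
      where open ≤-Reasoning

    ∑-load : sum load ≡ 2 * size
    ∑-load = begin
      sum load                                          ≡⟨ ∑-comm (λ v i → degreeIn G (C i) v) ⟩
      ∑[ i < k ] ∑[ v < #V ] degreeIn G (C i) v         ≡⟨ sum-cong-≗ (λ i → degreeIn-handshake (C i)) ⟩
      ∑[ i < k ] (2 * ∣ C i ∣)                          ≡⟨ sym (*-distribˡ-sum 2 (λ i → ∣ C i ∣)) ⟩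
      2 * size                                          ∎
      where open ≡-Reasoning

    3*∑4≡2*4E : 3 * ∑[ v < #V ] 4 ≡ 2 * (4 * #E)
    3*∑4≡2*4E = begin
      3 * ∑[ v < #V ] 4  ≡⟨ cong (3 *_) (∑-const #V 4) ⟩
      3 * (#V * 4)       ≡⟨ solve 1 (λ x → con 3 :* (x :* con 4) := con 4 :* (x :* con 3)) refl #V ⟩
      4 * (#V * 3)       ≡⟨ cong (4 *_) 3V≡2E ⟩
      4 * (2 * #E)       ≡⟨ solve 1 (λ x → con 4 :* (con 2 :* x) := con 2 :* (con 4 :* x)) refl #E ⟩
      2 * (4 * #E)       ∎
      where
      open ≡-Reasoning
      open +-*-Solver

    3*∑load≡2*3size : 3 * sum load ≡ 2 * (3 * size)
    3*∑load≡2*3size = trans (cong (3 *_) ∑-load)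
      (solve 1 (λ x → con 3 :* (con 2 :* x) := con 2 :* (con 3 :* x)) refl size)
      where open +-*-Solver

    4E≤3size : 4 * #E ≤ 3 * size
    4E≤3size = *-cancelˡ-≤ 2 (subst₂ _≤_ 3*∑4≡2*4E 3*∑load≡2*3size (*-monoʳ-≤ 3 (∑-mono 4≤load)))

    module Tight (3size≤4E : 3 * size ≤ 4 * #E) where

      load≡4 : ∀ v → 4 ≡ load v
      load≡4 = ∑-mono-tight 4≤load
        (*-cancelˡ-≤ 3 (subst₂ _≤_ (sym 3*∑load≡2*3size) (sym 3*∑4≡2*4E) (*-monoʳ-≤ 2 3size≤4E)))

      -- Every edge is covered, so the truncation in `∸` never takes effect.
      excess : E G → ℕ
      excess e = mult e ∸ 1

      mult≡1+excess : ∀ e → mult e ≡ 1 + excess e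
      mult≡1+excess e = sym (m+[n∸m]≡n (covers e))

      -- The load 4 exceeds the degree 3 by one, so the surplus coverage at each vertex is a single
      -- unit on a single edge.
      ∑-excess : ∀ v → ∑[ e < #E ] (excess e * inc v e) ≡ 1
      ∑-excess v = +-cancelˡ-≡ 3 _ _ (begin
        3 + ∑[ e < #E ] (excess e * inc v e)
          ≡⟨ cong (_+ ∑[ e < #E ] (excess e * inc v e)) (trans (sym (cubic v)) (degree≡∑ v)) ⟩
        ∑[ e < #E ] inc v e + ∑[ e < #E ] (excess e * inc v e)
          ≡⟨ sym (∑-distrib-+ (inc v) (λ e → excess e * inc v e)) ⟩
        ∑[ e < #E ] (inc v e + excess e * inc v e)
          ≡⟨ sum-cong-≗ (λ e → cong (_* inc v e) (sym (mult≡1+excess e))) ⟩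
        ∑[ e < #E ] (mult e * inc v e)
          ≡⟨ sym (∑-degreeIn C v) ⟩
        load v
          ≡⟨ sym (load≡4 v) ⟩
        4 ∎)
        where open ≡-Reasoning

      excess≤1 : ∀ e → excess e ≤ 1
      excess≤1 e = begin
        excess e                                ≡⟨ sym (*-identityʳ (excess e)) ⟩
        excess e * 1                            ≡⟨ cong (excess e *_) (sym (inc-true (inj₁ refl))) ⟩
        excess e * inc v e                      ≤⟨ term≤∑ (λ e → excess e * inc v e) e ⟩
        ∑[ e < #E ] (excess e * inc v e)        ≡⟨ ∑-excess v ⟩
        1                                       ∎
        where
        open ≤-Reasoning
        v = proj₁ (ends e)

      M : EdgeSet G
      M = tabulate (λ e → 0 <ᵇ excess e)

      χM≡excess : ∀ e → χ M e ≡ excess e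
      χM≡excess e = trans (cong 𝟙 (lookup∘tabulate (λ e → 0 <ᵇ excess e) e)) (𝟙-positive (excess≤1 e))

      mult≡1+χM : ∀ e → mult e ≡ 1 + χ M e
      mult≡1+χM e = trans (mult≡1+excess e) (cong suc (sym (χM≡excess e)))

      M-perfect : IsPerfectMatching G M
      M-perfect v = trans (degreeIn≡∑ M v)
        (trans (sum-cong-≗ (λ e → cong (_* inc v e) (χM≡excess e))) (∑-excess v))

      -- The one edge of `M` at `v` lies in exactly two of the cycles, which gives total degree 2
      -- before doubling.
      ∑-degree-M∩C : ∀ v → ∑[ i < k ] (2 * degreeIn G (M ∩ C i) v) ≡ 4
      ∑-degree-M∩C v = begin
        ∑[ i < k ] (2 * degreeIn G (M ∩ C i) v)
          ≡⟨ sym (*-distribˡ-sum 2 (λ i → degreeIn G (M ∩ C i) v)) ⟩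
        2 * ∑[ i < k ] degreeIn G (M ∩ C i) v
          ≡⟨ cong (2 *_) (∑-degreeIn (λ i → M ∩ C i) v) ⟩
        2 * ∑[ e < #E ] (∑[ i < k ] χ (M ∩ C i) e * inc v e)
          ≡⟨ cong (2 *_) (sum-cong-≗ (λ e → cong (_* inc v e) (doubled e))) ⟩
        2 * ∑[ e < #E ] (2 * χ M e * inc v e)
          ≡⟨ cong (2 *_) (sum-cong-≗ (λ e → *-assoc 2 (χ M e) (inc v e))) ⟩
        2 * ∑[ e < #E ] (2 * (χ M e * inc v e))
          ≡⟨ cong (2 *_) (sym (*-distribˡ-sum 2 (λ e → χ M e * inc v e))) ⟩
        2 * (2 * ∑[ e < #E ] (χ M e * inc v e))
          ≡⟨ cong (λ x → 2 * (2 * x)) (trans (sym (degreeIn≡∑ M v)) (M-perfect v)) ⟩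
        4 ∎
        where
        open ≡-Reasoning
        doubled : ∀ e → ∑[ i < k ] χ (M ∩ C i) e ≡ 2 * χ M e
        doubled e = begin
          ∑[ i < k ] χ (M ∩ C i) e        ≡⟨ sum-cong-≗ (λ i → χ-∩ M (C i) e) ⟩
          ∑[ i < k ] (χ M e * χ (C i) e)  ≡⟨ sym (*-distribˡ-sum (χ M e) (λ i → χ (C i) e)) ⟩
          χ M e * mult e                  ≡⟨ cong (χ M e *_) (mult≡1+χM e) ⟩
          χ M e * (1 + χ M e)             ≡⟨ *-distribˡ-+ (χ M e) 1 (χ M e) ⟩
          χ M e * 1 + χ M e * χ M e       ≡⟨ cong₂ _+_ (*-identityʳ (χ M e)) (trans (χ-idem M e) (sym (+-identityʳ (χ M e)))) ⟩
          2 * χ M e                       ∎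

      -- `M ∩ C i` has degree 0 or 1 at `v`, and an even number that is at least 1 is at least 2;
      -- hence `≤` holds for each `i`. Both sides total 4 over `i`, so no inequality is strict: a
      -- cycle either avoids `v` or has degree 2 there, using the edge of `M`.
      degree-C : ∀ v i → 2 * degreeIn G (M ∩ C i) v ≡ degreeIn G (C i) v
      degree-C v = ∑-mono-tight
        (λ i → even∧≥d⇒≥2d _ (even i v)
          (≤-trans (degreeIn-∩≤ˡ M (C i) v) (≤-reflexive (M-perfect v))) (degreeIn-∩≤ʳ M (C i) v))
        (≤-reflexive (trans (sym (load≡4 v)) (sym (∑-degree-M∩C v))))

      -- By `degree-C` the doubled overlap is the whole degree of `C i`, so the symmetric difference
      -- keeps only the degree 1 of `M`.
      M△C-perfect : ∀ i → IsPerfectMatching G (M △ C i)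
      M△C-perfect i v = +-cancelʳ-≡ (degreeIn G (C i) v) _ _ (begin
        degreeIn G (M △ C i) v + degreeIn G (C i) v
          ≡⟨ cong (degreeIn G (M △ C i) v +_) (sym (degree-C v i)) ⟩
        degreeIn G (M △ C i) v + 2 * degreeIn G (M ∩ C i) v
          ≡⟨ degreeIn-△ M (C i) v ⟩
        degreeIn G M v + degreeIn G (C i) v
          ≡⟨ cong (_+ degreeIn G (C i) v) (M-perfect v) ⟩
        1 + degreeIn G (C i) v ∎)
        where open ≡-Reasoning

  tight⇒factorisation : ∀ {t} (C : Fin (3 + t) → EdgeSet G) → (∀ i → IsCycle G (C i)) →
    (∀ e → 1 ≤ ∑[ i < 3 + t ] χ (C i) e) → 3 * ∑[ i < 3 + t ] ∣ C i ∣ ≤ 4 * #E →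
    ∃[ M ] (IsPerfectMatching G M × Factorisation G t M)
  tight⇒factorisation {t} C even covers 3size≤4E = M , M-perfect , record
    { factor  = λ i → M △ C i
    ; perfect = M△C-perfect
    ; exact   = exact
    }
    where
    open Family C even covers
    open Tight 3size≤4E
    exact : ∀ e → ∑[ i < 3 + t ] χ (M △ C i) e ≡ 1 + t * χ M e
    -- The cancelled `4 * m` is the overlap term `2 * (m * mult e)`, with `mult e` equal to `1 + m`
    -- and `m * m` equal to `m`.
    exact e = +-cancelʳ-≡ (4 * m) _ _ (begin
      x + 4 * m                  ≡⟨ cong (x +_) (solve 1 (λ m → con 4 :* m := con 2 :* (m :+ m)) refl m) ⟩
      x + 2 * (m + m)            ≡⟨ cong (λ y → x + 2 * (m + y)) (sym (χ-idem M e)) ⟩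
      x + 2 * (m + m * m)        ≡⟨ cong (λ y → x + 2 * y) (sym (*-suc m m)) ⟩
      x + 2 * (m * (1 + m))      ≡⟨ cong (λ y → x + 2 * (m * y)) (sym (mult≡1+χM e)) ⟩
      x + 2 * (m * mult e)       ≡⟨ ∑-△ M C e ⟩
      (3 + t) * m + mult e       ≡⟨ cong ((3 + t) * m +_) (mult≡1+χM e) ⟩
      (3 + t) * m + (1 + m)      ≡⟨ solve 2 (λ t m → (con 3 :+ t) :* m :+ (con 1 :+ m) := con 1 :+ t :* m :+ con 4 :* m) refl t m ⟩
      1 + t * m + 4 * m          ∎)
      where
      open ≡-Reasoning
      open +-*-Solver
      m = χ M e
      x = ∑[ i < 3 + t ] χ (M △ C i) e

  module FromFactorisation {t M} (M-perfect : IsPerfectMatching G M) (F : Factorisation G t M) where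
    open Factorisation F

    cycle : Fin (3 + t) → EdgeSet G
    cycle i = M △ factor i

    -- Two perfect matchings contribute 1 + 1 at each vertex, and removing twice the overlap keeps
    -- the parity.
    cycle-even : ∀ i → IsCycle G (cycle i)
    cycle-even i v = ∣m+n∣m⇒∣n
      (subst (2 ∣_) (sym (trans (+-comm (2 * degreeIn G (M ∩ factor i) v) _) (trans (degreeIn-△ M (factor i) v)
        (cong₂ _+_ (M-perfect v) (perfect i v))))) (divides 1 refl))
      (m∣m*n (degreeIn G (M ∩ factor i) v))

    -- An edge of `M` lies in `1 + t` of the `3 + t` factors, so it is missing from two of them and
    -- lies in exactly those two cycles. Any other edge lies in one factor and in the cycle of that
    -- factor only.
    multiplicity : ∀ e → ∑[ i < 3 + t ] χ (cycle i) e ≡ 1 + χ M e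
    multiplicity e = +-cancelʳ-≡ (2 * m + 2 * (t * m)) _ _ (begin
      x + (2 * m + 2 * (t * m))          ≡⟨ cong (λ y → x + (2 * m + 2 * (t * y))) (sym (χ-idem M e)) ⟩
      x + (2 * m + 2 * (t * (m * m)))    ≡⟨ solve 3 (λ x t m → x :+ (con 2 :* m :+ con 2 :* (t :* (m :* m))) := x :+ con 2 :* (m :* (con 1 :+ t :* m))) refl x t m ⟩
      x + 2 * (m * (1 + t * m))          ≡⟨ cong (λ y → x + 2 * (m * y)) (sym (exact e)) ⟩
      x + 2 * (m * ∑[ i < 3 + t ] χ (factor i) e)  ≡⟨ ∑-△ M factor e ⟩
      (3 + t) * m + ∑[ i < 3 + t ] χ (factor i) e  ≡⟨ cong ((3 + t) * m +_) (exact e) ⟩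
      (3 + t) * m + (1 + t * m)          ≡⟨ solve 2 (λ t m → (con 3 :+ t) :* m :+ (con 1 :+ t :* m) := con 1 :+ m :+ (con 2 :* m :+ con 2 :* (t :* m))) refl t m ⟩
      1 + m + (2 * m + 2 * (t * m))      ∎)
      where
      open ≡-Reasoning
      open +-*-Solver
      m = χ M e
      x = ∑[ i < 3 + t ] χ (cycle i) e

    3M≡E : 3 * ∣ M ∣ ≡ #E
    3M≡E = *-cancelˡ-≡ _ _ 2 (begin
      2 * (3 * ∣ M ∣)    ≡⟨ solve 1 (λ x → con 2 :* (con 3 :* x) := (con 2 :* x) :* con 3) refl ∣ M ∣ ⟩
      2 * ∣ M ∣ * 3      ≡⟨ cong (_* 3) (sym (degreeIn-handshake M)) ⟩
      ∑[ v < #V ] degreeIn G M v * 3  ≡⟨ cong (_* 3) (trans (sum-cong-≗ M-perfect) (trans (∑-const #V 1) (*-identityʳ #V))) ⟩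
      #V * 3             ≡⟨ 3V≡2E ⟩
      2 * #E             ∎)
      where
      open ≡-Reasoning
      open +-*-Solver

    3size≡4E : 3 * ∑[ i < 3 + t ] ∣ cycle i ∣ ≡ 4 * #E
    3size≡4E = begin
      3 * ∑[ i < 3 + t ] ∣ cycle i ∣
        ≡⟨ cong (3 *_) (sum-cong-≗ (λ i → ∣∣≡∑χ (cycle i))) ⟩
      3 * ∑[ i < 3 + t ] ∑[ e < #E ] χ (cycle i) e
        ≡⟨ cong (3 *_) (∑-comm (λ i e → χ (cycle i) e)) ⟩
      3 * ∑[ e < #E ] ∑[ i < 3 + t ] χ (cycle i) e
        ≡⟨ cong (3 *_) (sum-cong-≗ multiplicity) ⟩
      3 * ∑[ e < #E ] (1 + χ M e)
        ≡⟨ cong (3 *_) (∑-distrib-+ (λ _ → 1) (χ M)) ⟩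
      3 * (∑[ e < #E ] 1 + ∑[ e < #E ] χ M e)
        ≡⟨ cong₂ (λ x y → 3 * (x + y)) (trans (∑-const #E 1) (*-identityʳ #E)) (sym (∣∣≡∑χ M)) ⟩
      3 * (#E + ∣ M ∣)
        ≡⟨ *-distribˡ-+ 3 #E ∣ M ∣ ⟩
      3 * #E + 3 * ∣ M ∣
        ≡⟨ cong (3 * #E +_) 3M≡E ⟩
      3 * #E + #E
        ≡⟨ +-comm (3 * #E) #E ⟩
      4 * #E ∎
      where open ≡-Reasoning

-- Edge colourings of G + tM and factorisations

does-≟-sym : (i j : Fin n) → does (i ≟ j) ≡ does (j ≟ i)
does-≟-sym i j with i ≟ j | j ≟ i
... | yes _ | yes _ = refl
... | no  _ | no  _ = refl
... | yes p | no ¬p = contradiction (sym p) ¬p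
... | no ¬p | yes p = contradiction (sym p) ¬p

∑-δ′ : (j : Fin n) (f : Fin n → ℕ) → ∑[ i < n ] (f i * 𝟙 (does (i ≟ j))) ≡ f j
∑-δ′ j f = trans (sum-cong-≗ (λ i → *-comm (f i) _)) (∑-δ j f)

∧-true : ∀ {a b} → a ∧ b ≡ true → a ≡ true × b ≡ true
∧-true {true} {true} _ = refl , refl

max-const : ∀ {A : Set} (f : A → ℕ) d → (∀ x → f x ≡ d) → ∀ x xs → max 0 (map f (x ∷ xs)) ≡ d
max-const f d f≡d x xs = ≤-antisym
  (max≤v⁺ z≤n (AllP.map⁺ (All.universal (λ x → ≤-reflexive (f≡d x)) (x ∷ xs))))
  (v≤max⁺ 0 (map f (x ∷ xs)) (inj₂ (Any.here (≤-reflexive (sym (f≡d x))))))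

-- A vertex must exist, since the maximum over no vertices is the default 0.
maxDegree-regular : ∀ (H : Multigraph) d → 0 < Multigraph.#V H → (∀ v → degree H v ≡ d) → maxDegree H ≡ d
maxDegree-regular record { #V = suc _ } d _ regular = max-const _ d regular zero (List.tabulate suc)

module ColourClasses (H : Multigraph) {k} (c : E H → Fin k) (proper : IsProperEdgeColouring H c) where
  open Multigraph H
  open Degrees H

  classDegree : Fin k → V H → ℕ
  classDegree i v = ∑[ e < #E ] (𝟙 (does (i ≟ c e)) * inc v e)

  classDegree≤1 : ∀ i v → classDegree i v ≤ 1
  classDegree≤1 i v = subst (_≤ 1)
    (sum-cong-≗ (λ e → 𝟙-∧ (does (i ≟ c e)) (does (incident? H v e))))
    (∑𝟙≤1 (λ e → does (i ≟ c e) ∧ does (incident? H v e)) unique)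
    where
    unique : ∀ e f → does (i ≟ c e) ∧ does (incident? H v e) ≡ true →
             does (i ≟ c f) ∧ does (incident? H v f) ≡ true → e ≡ f
    unique e f pe pf with e ≟ f
    ... | yes e≡f = e≡f
    ... | no  e≢f =
      let ie , ve = ∧-true pe
          jf , vf = ∧-true pf
      in contradiction (trans (sym (does-true (i ≟ c e) ie)) (does-true (i ≟ c f) jf))
           (proper v e f (does-true (incident? H v e) ve) (does-true (incident? H v f) vf) e≢f)

  ∑-classDegree : ∀ v → ∑[ i < k ] classDegree i v ≡ degree H v
  ∑-classDegree v = begin
    ∑[ i < k ] classDegree i v
      ≡⟨ ∑-comm (λ i e → 𝟙 (does (i ≟ c e)) * inc v e) ⟩
    ∑[ e < #E ] ∑[ i < k ] (𝟙 (does (i ≟ c e)) * inc v e)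
      ≡⟨ sum-cong-≗ (λ e → ∑-δ (c e) (λ _ → inc v e)) ⟩
    ∑[ e < #E ] inc v e
      ≡⟨ sym (degree≡∑ v) ⟩
    degree H v ∎
    where open ≡-Reasoning

  degree≤#colours : ∀ v → degree H v ≤ k
  degree≤#colours v = subst₂ _≤_ (∑-classDegree v) (trans (∑-const k 1) (*-identityʳ k))
    (∑-mono (λ i → classDegree≤1 i v))

  -- Each of the `k` colours occurs at most once at `v`, and together they occur `k` times.
  classDegree≡1 : ∀ v → degree H v ≡ k → ∀ i → classDegree i v ≡ 1
  classDegree≡1 v full = ∑-mono-tight (λ i → classDegree≤1 i v)
    (≤-reflexive (trans (trans (∑-const k 1) (*-identityʳ k)) (trans (sym full) (sym (∑-classDegree v)))))

-- `original` agrees definitionally with the local function of the same name in `addCopies`.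
original : ∀ {m} t (M : Subset m) → Fin (m + t * ∣ M ∣) → Fin m
original {m} t M e = [ (λ e → e) , (λ j → nth M (remainder {t} ∣ M ∣ j)) ]′ (splitAt m e)

-- Number 0 is the edge of `G` itself, and the added blocks are numbered from 1. Together with
-- `original` this number determines the edge.
copy : ∀ {m} t (M : Subset m) → Fin (m + t * ∣ M ∣) → Fin (suc t)
copy {m} t M e = [ (λ _ → zero) , (λ j → suc (quotient {t} ∣ M ∣ j)) ]′ (splitAt m e)

∑-original : ∀ {m} t (M : Subset m) (f : Fin m → ℕ) →
             ∑[ e < m + t * ∣ M ∣ ] f (original t M e) ≡ sum f + t * ∑[ e < m ] (χ M e * f e)
∑-original {m} t M f = begin
  ∑[ e < m + t * ∣ M ∣ ] f (original t M e)
    ≡⟨ ∑-splitAt m (f ∘ [ (λ e → e) , (λ j → nth M (remainder {t} ∣ M ∣ j)) ]′) ⟩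
  sum f + ∑[ j < t * ∣ M ∣ ] f (nth M (remainder {t} ∣ M ∣ j))
    ≡⟨ cong (sum f +_) (∑-remainder t (f ∘ nth M)) ⟩
  sum f + t * ∑[ i < ∣ M ∣ ] f (nth M i)
    ≡⟨ cong (λ x → sum f + t * x) (∑-nth M f) ⟩
  sum f + t * ∑[ e < m ] (χ M e * f e) ∎
  where open ≡-Reasoning

original-copy-injective : ∀ {m} t (M : Subset m) e f →
  original t M e ≡ original t M f → copy t M e ≡ copy t M f → e ≡ f
original-copy-injective {m} t M e f eq eq′ =
  trans (sym (join-splitAt m _ e)) (trans (cong (join m _) (sides (splitAt m e) (splitAt m f) eq eq′)) (join-splitAt m _ f))
  where
  side-original : Fin m ⊎ Fin (t * ∣ M ∣) → Fin m
  side-original = [ (λ e → e) , (λ j → nth M (remainder {t} ∣ M ∣ j)) ]′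
  side-copy : Fin m ⊎ Fin (t * ∣ M ∣) → Fin (suc t)
  side-copy = [ (λ _ → zero) , (λ j → suc (quotient {t} ∣ M ∣ j)) ]′
  sides : ∀ a b → side-original a ≡ side-original b → side-copy a ≡ side-copy b → a ≡ b
  sides (inj₁ _) (inj₁ _) refl _ = refl
  sides (inj₂ i) (inj₂ j) p    q = cong inj₂ (begin
    i                                               ≡⟨ sym (combine-remQuot {t} ∣ M ∣ i) ⟩
    combine (quotient {t} ∣ M ∣ i) (remainder {t} ∣ M ∣ i)  ≡⟨ cong₂ combine (suc-injective q) (nth-injective M p) ⟩
    combine (quotient {t} ∣ M ∣ j) (remainder {t} ∣ M ∣ j)  ≡⟨ combine-remQuot {t} ∣ M ∣ j ⟩
    j                                               ∎)
    where open ≡-Reasoning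

-- The bound is the number of factors containing the original edge, so copy numbers can index those
-- factors.
copy-bound : ∀ {m} t (M : Subset m) e → toℕ (copy t M e) < 1 + t * χ M (original t M e)
copy-bound {m} t M e with splitAt m e
... | inj₁ _ = s≤s z≤n
... | inj₂ j rewrite lookup-nth M (remainder {t} ∣ M ∣ j) | *-identityʳ t =
  s≤s (toℕ<n (quotient {t} ∣ M ∣ j))

module MatchingCopies (G : Multigraph) (cubic : Cubic G) (nonempty : 0 < Multigraph.#V G)
                      (t : ℕ) (M : EdgeSet G) (M-perfect : IsPerfectMatching G M) where
  open Multigraph G
  open Degrees G

  H : Multigraph
  H = addCopies G t M

  #E′ : ℕ
  #E′ = #E + t * ∣ M ∣

  orig : Fin #E′ → Fin #E
  orig = original t M

  degree-H : ∀ v → degree H v ≡ 3 + t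
  degree-H v = begin
    degree H v
      ≡⟨ Degrees.degree≡∑ H v ⟩
    ∑[ e < #E′ ] inc v (orig e)
      ≡⟨ ∑-original t M (inc v) ⟩
    ∑[ e < #E ] inc v e + t * ∑[ e < #E ] (χ M e * inc v e)
      ≡⟨ cong₂ (λ x y → x + t * y) (trans (sym (degree≡∑ v)) (cubic v)) (trans (sym (degreeIn≡∑ M v)) (M-perfect v)) ⟩
    3 + t * 1
      ≡⟨ cong (3 +_) (*-identityʳ t) ⟩
    3 + t ∎
    where open ≡-Reasoning

  maxDegree-H : maxDegree H ≡ 3 + t
  maxDegree-H = maxDegree-regular H (3 + t) nonempty degree-H

  colourable⇒classI : EdgeColourable H (3 + t) → ClassI H
  colourable⇒classI colourable = subst (EdgeColourable H) (sym maxDegree-H) colourable ,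
    λ k (c , proper) → subst (_≤ k) (trans (degree-H v₀) (sym maxDegree-H))
      (ColourClasses.degree≤#colours H c proper v₀)
    where
    v₀ : V G
    v₀ = fromℕ< nonempty

  classI⇒factorisation : ClassI H → Factorisation G t M
  classI⇒factorisation (colourable , _) with c , proper ← subst (EdgeColourable H) maxDegree-H colourable = record
    { factor  = factor
    ; perfect = factor-perfect
    ; exact   = factor-exact
    }
    where
    open ColourClasses H c proper

    -- The number of edges of `H` over `e` with colour `i`; by `count≤1` it is the indicator of the
    -- trace of the colour class.
    count : Fin (3 + t) → E G → ℕ
    count i e = ∑[ e′ < #E′ ] (𝟙 (does (e ≟ orig e′)) * 𝟙 (does (i ≟ c e′)))

    -- A copy has the ends of its original, so regrouping by copies yields the degree of colour `i`
    -- at `v` in `H`.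
    ∑-count-inc : ∀ i v → ∑[ e < #E ] (count i e * inc v e) ≡ 1
    ∑-count-inc i v = begin
      ∑[ e < #E ] (count i e * inc v e)
        ≡⟨ sum-cong-≗ (λ e → *-distribʳ-sum (inc v e) (λ e′ → 𝟙 (does (e ≟ orig e′)) * 𝟙 (does (i ≟ c e′)))) ⟩
      ∑[ e < #E ] ∑[ e′ < #E′ ] (𝟙 (does (e ≟ orig e′)) * 𝟙 (does (i ≟ c e′)) * inc v e)
        ≡⟨ ∑-comm (λ e e′ → 𝟙 (does (e ≟ orig e′)) * 𝟙 (does (i ≟ c e′)) * inc v e) ⟩
      ∑[ e′ < #E′ ] ∑[ e < #E ] (𝟙 (does (e ≟ orig e′)) * 𝟙 (does (i ≟ c e′)) * inc v e)
        ≡⟨ sum-cong-≗ (λ e′ → trans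
             (sum-cong-≗ (λ e → *-assoc (𝟙 (does (e ≟ orig e′))) (𝟙 (does (i ≟ c e′))) (inc v e)))
             (∑-δ (orig e′) (λ e → 𝟙 (does (i ≟ c e′)) * inc v e))) ⟩
      classDegree i v
        ≡⟨ classDegree≡1 v (degree-H v) i ⟩
      1 ∎
      where open ≡-Reasoning

    count≤1 : ∀ i e → count i e ≤ 1
    count≤1 i e = begin
      count i e                              ≡⟨ sym (*-identityʳ (count i e)) ⟩
      count i e * 1                          ≡⟨ cong (count i e *_) (sym (inc-true (inj₁ refl))) ⟩
      count i e * inc v e                    ≤⟨ term≤∑ (λ e → count i e * inc v e) e ⟩
      ∑[ e < #E ] (count i e * inc v e)      ≡⟨ ∑-count-inc i v ⟩
      1                                      ∎
      where
      open ≤-Reasoning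
      v = proj₁ (ends e)

    factor : Fin (3 + t) → EdgeSet G
    factor i = tabulate (λ e → 0 <ᵇ count i e)

    χ-factor : ∀ i e → χ (factor i) e ≡ count i e
    χ-factor i e = trans (cong 𝟙 (lookup∘tabulate (λ e → 0 <ᵇ count i e) e)) (𝟙-positive (count≤1 i e))

    factor-perfect : ∀ i → IsPerfectMatching G (factor i)
    factor-perfect i v = trans (degreeIn≡∑ (factor i) v)
      (trans (sum-cong-≗ (λ e → cong (_* inc v e) (χ-factor i e))) (∑-count-inc i v))

    -- Each copy has exactly one colour, so summing over colours just counts the copies of `e`.
    factor-exact : ∀ e → ∑[ i < 3 + t ] χ (factor i) e ≡ 1 + t * χ M e
    factor-exact e = begin
      ∑[ i < 3 + t ] χ (factor i) e
        ≡⟨ sum-cong-≗ (λ i → χ-factor i e) ⟩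
      ∑[ i < 3 + t ] count i e
        ≡⟨ ∑-comm (λ i e′ → 𝟙 (does (e ≟ orig e′)) * 𝟙 (does (i ≟ c e′))) ⟩
      ∑[ e′ < #E′ ] ∑[ i < 3 + t ] (𝟙 (does (e ≟ orig e′)) * 𝟙 (does (i ≟ c e′)))
        ≡⟨ sum-cong-≗ (λ e′ → trans (∑-δ′ (c e′) (λ _ → 𝟙 (does (e ≟ orig e′)))) (cong 𝟙 (does-≟-sym e (orig e′)))) ⟩
      ∑[ e′ < #E′ ] 𝟙 (does (orig e′ ≟ e))
        ≡⟨ ∑-original t M (λ x → 𝟙 (does (x ≟ e))) ⟩
      ∑[ x < #E ] 𝟙 (does (x ≟ e)) + t * ∑[ x < #E ] (χ M x * 𝟙 (does (x ≟ e)))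
        ≡⟨ cong₂ (λ x y → x + t * y) (∑-δ₁ e) (∑-δ′ e (χ M)) ⟩
      1 + t * χ M e ∎
      where open ≡-Reasoning

  factorisation⇒classI : Factorisation G t M → ClassI H
  factorisation⇒classI F = colourable⇒classI (colour , proper)
    where
    open Factorisation F

    factorsAt : E G → Subset (3 + t)
    factorsAt e = tabulate (λ i → lookup (factor i) e)

    ∣factorsAt∣ : ∀ e → ∣ factorsAt e ∣ ≡ 1 + t * χ M e
    ∣factorsAt∣ e = trans (∣∣≡∑χ (factorsAt e))
      (trans (sum-cong-≗ (λ i → cong 𝟙 (lookup∘tabulate (λ i → lookup (factor i) e) i))) (exact e))

    bound : ∀ e → toℕ (copy t M e) < ∣ factorsAt (orig e) ∣
    bound e = subst (toℕ (copy t M e) <_) (sym (∣factorsAt∣ (orig e))) (copy-bound t M e)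

    -- The copies of an edge receive, in order, the factors that contain it; there are as many of
    -- these as copies.
    colour : E H → Fin (3 + t)
    colour e = nth (factorsAt (orig e)) (fromℕ< (bound e))

    in-factor : ∀ e → lookup (factor (colour e)) (orig e) ≡ true
    in-factor e = trans (sym (lookup∘tabulate (λ i → lookup (factor i) (orig e)) (colour e)))
      (lookup-nth (factorsAt (orig e)) (fromℕ< (bound e)))

    nth-fromℕ<-injective : ∀ {S T : Subset (3 + t)} {a b} → S ≡ T → (p : a < ∣ S ∣) (q : b < ∣ T ∣) →
      nth S (fromℕ< p) ≡ nth T (fromℕ< q) → a ≡ b
    nth-fromℕ<-injective {S} refl p q eq = fromℕ<-injective _ _ p q (nth-injective S eq)

    -- If two edges at `v` share a colour, their originals lie in one perfect matching and meet at
    -- `v`, so the originals coincide. Equal positions in the same list of factors then force equal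
    -- copy numbers.
    proper : IsProperEdgeColouring H colour
    proper v e f ve vf e≢f same = e≢f (original-copy-injective t M e f orig≡
      (toℕ-injective (nth-fromℕ<-injective (cong factorsAt orig≡) (bound e) (bound f) same)))
      where
      i = colour e
      p : E G → Bool
      p x = lookup (factor i) x ∧ does (incident? G v x)
      p-true : ∀ {x} → lookup (factor i) x ≡ true → Incident G v x → p x ≡ true
      p-true {x} a b = cong₂ _∧_ a (dec-true (incident? G v x) b)
      orig≡ : orig e ≡ orig f
      orig≡ = ∑𝟙≤1⇒unique p
        (≤-reflexive (trans (sum-cong-≗ (λ x → 𝟙-∧ (lookup (factor i) x) (does (incident? G v x))))
          (trans (sym (degreeIn≡∑ (factor i) v)) (perfect i v))))
        (orig e) (orig f) (p-true (in-factor e) ve)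
        (p-true (subst (λ j → lookup (factor j) (orig f) ≡ true) (sym same) (in-factor f)) vf)

-- A cycle through each edge of a bridgeless graph

χ-⊥ : ∀ (i : Fin n) → χ ⊥ i ≡ 0
χ-⊥ i = cong 𝟙 (lookup-replicate i outside)

χ-⁅⁆ : ∀ (i j : Fin n) → χ ⁅ j ⁆ i ≡ 𝟙 (does (i ≟ j))
χ-⁅⁆ zero    zero    = refl
χ-⁅⁆ (suc i) zero    = χ-⊥ i
χ-⁅⁆ zero    (suc j) = refl
χ-⁅⁆ (suc i) (suc j) = χ-⁅⁆ i j

module Circuits (G : Multigraph) where
  open Multigraph G
  open Degrees G

  degreeIn-⊥ : ∀ v → degreeIn G ⊥ v ≡ 0
  degreeIn-⊥ v = trans (degreeIn≡∑ ⊥ v)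
    (∑-zero (λ e → χ ⊥ e * inc v e) (λ e → cong (_* inc v e) (χ-⊥ e)))

  ⊥-cycle : IsCycle G ⊥
  ⊥-cycle v = subst (2 ∣_) (sym (degreeIn-⊥ v)) (2 ∣0)

  degreeIn-⁅⁆ : ∀ e v → degreeIn G ⁅ e ⁆ v ≡ inc v e
  degreeIn-⁅⁆ e v = trans (degreeIn≡∑ ⁅ e ⁆ v)
    (trans (sum-cong-≗ (λ x → cong (_* inc v x) (χ-⁅⁆ x e))) (∑-δ e (inc v)))

  inc-distinct : ∀ {u v} e → Incident G u e → Incident G v e → u ≢ v →
                 ∀ x → inc x e ≡ 𝟙 (does (x ≟ u)) + 𝟙 (does (x ≟ v))
  inc-distinct e (inj₁ refl) (inj₁ refl) u≢v x = contradiction refl u≢v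
  inc-distinct e (inj₁ refl) (inj₂ refl) u≢v x = inc-ends x e
  inc-distinct e (inj₂ refl) (inj₁ refl) u≢v x = trans (inc-ends x e) (+-comm (𝟙 (does (x ≟ proj₁ (ends e)))) _)
  inc-distinct e (inj₂ refl) (inj₂ refl) u≢v x = contradiction refl u≢v

  -- D is the mod-2 sum of the edges of the walk.
  walk⇒edges : ∀ {F u w} → Walk G F u w → ∃[ D ] (
    (∀ e → e ∈ F → lookup D e ≡ false) ×
    (∀ x → 2 ∣ degreeIn G D x + (𝟙 (does (x ≟ u)) + 𝟙 (does (x ≟ w)))))
  walk⇒edges {u = u} stop = ⊥ , (λ e _ → lookup-replicate e outside) ,
    λ x → subst (2 ∣_) (sym (cong₂ _+_ (degreeIn-⊥ x) (cong (𝟙 (does (x ≟ u)) +_) (sym (+-identityʳ (𝟙 (does (x ≟ u))))))))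
      (m∣m*n (𝟙 (does (x ≟ u))))
  walk⇒edges {F} {u} {w} (step {v = v} e e∉F u∈e v∈e walk) with u ≟ v | walk⇒edges walk
  -- `Walk` allows a step that names the same end of `e` twice; such a step does not move, and its
  -- edge is left out.
  ... | yes refl | IH = IH
  ... | no  u≢v  | D , avoids , parity = D △ ⁅ e ⁆ , avoids′ , parity′
    where
    avoids′ : ∀ f → f ∈ F → lookup (D △ ⁅ e ⁆) f ≡ false
    avoids′ f f∈F = trans (lookup-zipWith _xor_ f D ⁅ e ⁆) (cong₂ _xor_ (avoids f f∈F) f∉⁅e⁆)
      where
      f∉⁅e⁆ : lookup ⁅ e ⁆ f ≡ false
      f∉⁅e⁆ with lookup ⁅ e ⁆ f in eq
      ... | false = refl
      ... | true  = contradiction (subst (_∈ F) (x∈⁅y⁆⇒x≡y e (lookup⇒[]= f ⁅ e ⁆ eq)) f∈F) e∉F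
    parity′ : ∀ x → 2 ∣ degreeIn G (D △ ⁅ e ⁆) x + (𝟙 (does (x ≟ u)) + 𝟙 (does (x ≟ w)))
    -- Adding `e` flips the parity exactly at `u` and `v`, which moves the odd end from `v` to `u`.
    parity′ x = ∣m+n∣m⇒∣n
      (subst (2 ∣_) (sym rearranged) (∣m∣n⇒∣m+n (m∣m*n (δ u)) (parity x)))
      (m∣m*n both)
      where
      open ≡-Reasoning
      open +-*-Solver
      δ : V G → ℕ
      δ y = 𝟙 (does (x ≟ y))
      new  = degreeIn G (D △ ⁅ e ⁆) x
      both = degreeIn G (D ∩ ⁅ e ⁆) x
      old  = degreeIn G D x
      rearranged : 2 * both + (new + (δ u + δ w)) ≡ 2 * δ u + (old + (δ v + δ w))
      rearranged = begin
        2 * both + (new + (δ u + δ w))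
          ≡⟨ solve 3 (λ b n d → con 2 :* b :+ (n :+ d) := n :+ con 2 :* b :+ d) refl both new (δ u + δ w) ⟩
        new + 2 * both + (δ u + δ w)
          ≡⟨ cong (_+ (δ u + δ w)) (degreeIn-△ D ⁅ e ⁆ x) ⟩
        old + degreeIn G ⁅ e ⁆ x + (δ u + δ w)
          ≡⟨ cong (λ y → old + y + (δ u + δ w)) (trans (degreeIn-⁅⁆ e x) (inc-distinct e u∈e v∈e u≢v x)) ⟩
        old + (δ u + δ v) + (δ u + δ w)
          ≡⟨ solve 4 (λ o a b c → o :+ (a :+ b) :+ (a :+ c) := con 2 :* a :+ (o :+ (b :+ c))) refl old (δ u) (δ v) (δ w) ⟩
        2 * δ u + (old + (δ v + δ w)) ∎

  -- Deleting `e` leaves its ends joined by a walk. The mod-2 sum of that walk is odd only at these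
  -- ends and avoids `e`, so adding `e` makes every degree even.
  cycleThrough : Bridgeless G → ∀ e → ∃[ C ] (IsCycle G C × e ∈ C)
  cycleThrough (_ , connected) e
    with D , avoids , parity ← walk⇒edges (connected ⁅ e ⁆ (≤-reflexive (cong suc (∣⁅x⁆∣≡1 e)))
                                             (proj₁ (ends e)) (proj₂ (ends e)))
    = D △ ⁅ e ⁆ , even ,
      lookup⇒[]= e (D △ ⁅ e ⁆) (trans (lookup-zipWith _xor_ e D ⁅ e ⁆)
        (cong₂ _xor_ (avoids e (x∈⁅x⁆ e)) ([]=⇒lookup (x∈⁅x⁆ e))))
    where
    even : IsCycle G (D △ ⁅ e ⁆)
    even x = ∣m+n∣m⇒∣n
      (subst (2 ∣_) (sym (trans (+-comm (2 * degreeIn G (D ∩ ⁅ e ⁆) x) _) (trans (degreeIn-△ D ⁅ e ⁆ x)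
        (cong (degreeIn G D x +_) (trans (degreeIn-⁅⁆ e x) (inc-ends x e)))))) (parity x))
      (m∣m*n (degreeIn G (D ∩ ⁅ e ⁆) x))

  bridgeless⇒cover : Bridgeless G → ∃[ 𝒞 ] IsCycleCover G 𝒞
  bridgeless⇒cover bridgeless = List.tabulate (λ e → proj₁ (cycleThrough bridgeless e)) ,
    AllP.tabulate⁺ (λ e → proj₁ (proj₂ (cycleThrough bridgeless e))) ,
    λ e → AnyP.tabulate⁺ e (proj₂ (proj₂ (cycleThrough bridgeless e)))

-- Existence of a shortest cycle cover

minimum : {P : ℕ → Set} → Decidable P → ∀ {n} → P n → ∃[ m ] IsMinimum P m
minimum {P} P? {n} Pn with below (suc n)
  where
  below : ∀ n → (∃[ m ] IsMinimum P m) ⊎ (∀ k → k < n → ¬ P k)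
  below zero = inj₂ λ _ ()
  below (suc n) with below n
  ... | inj₁ found = inj₁ found
  ... | inj₂ none with P? n
  ...   | yes Pn = inj₁ (n , Pn , λ k Pk → ≮⇒≥ (λ k<n → none k k<n Pk))
  ...   | no ¬Pn = inj₂ λ k k<1+n Pk → [ (λ k<n → none k k<n Pk) , (λ { refl → ¬Pn Pk }) ]′ (m<1+n⇒m<n∨m≡n k<1+n)
... | inj₁ found = found
... | inj₂ none  = contradiction Pn (none n ≤-refl)

-- The head is searched by `any?`, and the tail recursively with the head fixed; the length bound
-- makes the search end.
anyShortList? : ∀ {A : Set} → (∀ {P : A → Set} → Decidable P → Dec (∃[ x ] P x)) →
  ∀ l {R : List A → Set} → Decidable R → Dec (∃[ xs ] (List.length xs ≤ l × R xs))
anyShortList? any? zero R? = map′ (λ r → [] , z≤n , r) (λ { ([] , _ , r) → r }) (R? [])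
anyShortList? any? (suc l) R? = map′
  [ (λ r → [] , z≤n , r) , (λ (x , xs , l≤ , r) → x ∷ xs , s≤s l≤ , r) ]′
  (λ { ([] , _ , r) → inj₁ r ; (x ∷ xs , s≤s l≤ , r) → inj₂ (x , xs , l≤ , r) })
  (R? [] ⊎-dec any? (λ x → anyShortList? any? l (λ xs → R? (x ∷ xs))))

length≤sum : ∀ {A : Set} (f : A → ℕ) xs → All (λ x → 1 ≤ f x) xs → List.length xs ≤ ListAction.sum (map f xs)
length≤sum f []       []       = z≤n
length≤sum f (x ∷ xs) (p ∷ ps) = +-mono-≤ p (length≤sum f xs ps)

∑-lookup : ∀ {A : Set} (f : A → ℕ) xs → ∑[ i < List.length xs ] f (List.lookup xs i) ≡ ListAction.sum (map f xs)
∑-lookup f []       = refl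
∑-lookup f (x ∷ xs) = cong (f x +_) (∑-lookup f xs)

∑-tabulate : ∀ {A : Set} (f : A → ℕ) (g : Fin n → A) → ListAction.sum (map f (List.tabulate g)) ≡ ∑[ i < n ] f (g i)
∑-tabulate {zero}  f g = refl
∑-tabulate {suc n} f g = cong (f (g zero) +_) (∑-tabulate f (g ∘ suc))

∈⇒1≤χ : ∀ {S : Subset n} {i} → i ∈ S → 1 ≤ χ S i
∈⇒1≤χ i∈S = ≤-reflexive (sym (cong 𝟙 ([]=⇒lookup i∈S)))

∈⇒1≤∣∣ : ∀ {S : Subset n} {i} → i ∈ S → 1 ≤ ∣ S ∣
∈⇒1≤∣∣ {S = S} {i} i∈S = ≤-trans (∈⇒1≤χ i∈S) (≤-trans (term≤∑ (χ S) i) (≤-reflexive (sym (∣∣≡∑χ S))))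

module Covers (G : Multigraph) where
  open Multigraph G

  positive? : (S : EdgeSet G) → Dec (1 ≤ ∣ S ∣)
  positive? S = 1 ≤? ∣ S ∣

  coverLength-nonempties : ∀ 𝒞 → coverLength G (List.filter positive? 𝒞) ≡ coverLength G 𝒞
  coverLength-nonempties []      = refl
  coverLength-nonempties (C ∷ 𝒞) with positive? C
  ... | yes ∣C∣≥1 = trans (cong (coverLength G) (filter-accept positive? {x = C} {xs = 𝒞} ∣C∣≥1))
    (cong (∣ C ∣ +_) (coverLength-nonempties 𝒞))
  ... | no  ∣C∣≱1 = trans (cong (coverLength G) (filter-reject positive? {x = C} {xs = 𝒞} ∣C∣≱1))
    (trans (coverLength-nonempties 𝒞) (cong (_+ coverLength G 𝒞) (sym (n<1⇒n≡0 (≰⇒> ∣C∣≱1)))))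

  -- A member containing an edge is not empty, so the filter never removes the one that covers `e`.
  nonempties-cover : ∀ {𝒞} → IsCycleCover G 𝒞 → IsCycleCover G (List.filter positive? 𝒞)
  nonempties-cover (cycles , covers) = AllP.filter⁺ positive? cycles ,
    λ e → [ id , (λ empty → contradiction (∈⇒1≤∣∣ (AnyP.lookup-result (covers e))) empty) ]′
            (AnyP.filter⁺ positive? (covers e))

  HasCover : ℕ → Set
  HasCover l = ∃[ 𝒞 ] (IsCycleCover G 𝒞 × coverLength G 𝒞 ≡ l)

  isCycleCover? : Decidable (IsCycleCover G)
  isCycleCover? 𝒞 = All.all? (λ C → all? (λ v → 2 ∣? degreeIn G C v)) 𝒞
              ×-dec all? (λ e → Any.any? (e ∈?_) 𝒞)

  -- Empty cycles may be dropped, so a cover of length l needs at most l members.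
  hasCover? : Decidable HasCover
  hasCover? l = map′ (λ (𝒞 , _ , covers) → 𝒞 , covers) shorten
    (anyShortList? anySubset? l (λ 𝒞 → isCycleCover? 𝒞 ×-dec (coverLength G 𝒞 ≟ℕ l)))
    where
    shorten : HasCover l → ∃[ 𝒞 ] (List.length 𝒞 ≤ l × IsCycleCover G 𝒞 × coverLength G 𝒞 ≡ l)
    shorten (𝒞 , cover , refl) = List.filter positive? 𝒞 ,
      subst (List.length (List.filter positive? 𝒞) ≤_) (coverLength-nonempties 𝒞)
        (length≤sum ∣_∣ (List.filter positive? 𝒞) (AllP.all-filter positive? 𝒞)) ,
      nonempties-cover {𝒞} cover , coverLength-nonempties 𝒞

  scc-exists : Bridgeless G → ∃[ s ] IsScc G s
  scc-exists bridgeless with 𝒞 , cover ← Circuits.bridgeless⇒cover G bridgeless =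
    minimum hasCover? (𝒞 , cover , refl)

  members-even : ∀ {𝒞} → IsCycleCover G 𝒞 → ∀ i → IsCycle G (List.lookup 𝒞 i)
  members-even (cycles , _) i = All.lookup cycles (∈-lookup i)

  members-cover : ∀ {𝒞} → IsCycleCover G 𝒞 → ∀ e → 1 ≤ ∑[ i < List.length 𝒞 ] χ (List.lookup 𝒞 i) e
  members-cover {𝒞} (_ , covers) e = ≤-trans (∈⇒1≤χ (AnyP.lookup-index (covers e)))
    (term≤∑ (λ i → χ (List.lookup 𝒞 i) e) (Any.index (covers e)))

  familyCover : ∀ {k} (C : Fin k → EdgeSet G) → (∀ i → IsCycle G (C i)) →
    (∀ e → 1 ≤ ∑[ i < k ] χ (C i) e) →
    ∃[ 𝒞 ] (IsCycleCover G 𝒞 × coverLength G 𝒞 ≡ ∑[ i < k ] ∣ C i ∣)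
  familyCover C even covers = List.tabulate C , (AllP.tabulate⁺ even , covered) , ∑-tabulate ∣_∣ C
    where
    covered : ∀ e → Any (e ∈_) (List.tabulate C)
    covered e =
      let i , 1≤χ = ∑-positive (λ i → χ (C i) e) (covers e)
      in AnyP.tabulate⁺ i (lookup⇒[]= e (C i) (𝟙≥1⇒true 1≤χ))

-- Comparing scc(G) with 4|E|/3

module SccBounds (G : Multigraph) (bridgeless : Bridgeless G) (cubic : Cubic G) where
  open Multigraph G
  open Covers G
  open CubicGraph G cubic

  0<V : 0 < #V
  0<V = <-trans (s≤s z≤n) (proj₁ bridgeless)

  4E≤3length : ∀ {𝒞} → IsCycleCover G 𝒞 → 4 * #E ≤ 3 * coverLength G 𝒞
  4E≤3length {𝒞} cover = subst (λ l → 4 * #E ≤ 3 * l) (∑-lookup ∣_∣ 𝒞)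
    (Family.4E≤3size (List.lookup 𝒞) (members-even cover) (members-cover cover))

  -- Three empty cycles are added so that the number of members has the form 3 + t.
  frumious⇒4E<3length : Frumious G → ∀ {𝒞} → IsCycleCover G 𝒞 → 4 * #E < 3 * coverLength G 𝒞
  frumious⇒4E<3length frumious {𝒞} cover@(cycles , covers) = ≰⇒> λ tight →
    let M , M-perfect , F = tight⇒factorisation (List.lookup 𝒞⁺) (members-even cover⁺) (members-cover cover⁺)
                              (subst (λ l → 3 * l ≤ 4 * #E) (sym size⁺) tight)
    in frumious M M-perfect (List.length 𝒞 , MatchingCopies.factorisation⇒classI G cubic 0<V (List.length 𝒞) M M-perfect F)
    where
    𝒞⁺ : List (EdgeSet G)
    𝒞⁺ = ⊥ ∷ ⊥ ∷ ⊥ ∷ 𝒞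
    ⊥-cycle = Circuits.⊥-cycle G
    cover⁺ : IsCycleCover G 𝒞⁺
    cover⁺ = ⊥-cycle ∷ ⊥-cycle ∷ ⊥-cycle ∷ cycles , λ e → there (there (there (covers e)))
    size⁺ : ∑[ i < 3 + List.length 𝒞 ] ∣ List.lookup 𝒞⁺ i ∣ ≡ coverLength G 𝒞
    size⁺ = trans (∑-lookup ∣_∣ 𝒞⁺)
      (cong (λ x → x + (x + (x + coverLength G 𝒞))) (∣⊥∣≡0 #E))

  factorisation⇒tightCover : ∀ {M t} → IsPerfectMatching G M → Factorisation G t M →
    ∃[ 𝒞 ] (IsCycleCover G 𝒞 × 3 * coverLength G 𝒞 ≡ 4 * #E)
  factorisation⇒tightCover M-perfect F =
    let 𝒞 , cover , length≡ = familyCover cycle cycle-even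
                                (λ e → subst (1 ≤_) (sym (multiplicity e)) (s≤s z≤n))
    in 𝒞 , cover , subst (λ l → 3 * l ≡ 4 * #E) (sym length≡) 3size≡4E
    where open FromFactorisation M-perfect F

  4E≤3scc : ∀ {s} → IsScc G s → 4 * #E ≤ 3 * s
  4E≤3scc ((_ , cover , refl) , _) = 4E≤3length cover

  frumious⇒4E<3scc : ∀ {s} → IsScc G s → Frumious G → 4 * #E < 3 * s
  frumious⇒4E<3scc ((_ , cover , refl) , _) frumious = frumious⇒4E<3length frumious cover

  -- A Class I `G + tM` would yield a cover of length exactly 4|E|/3, shorter than the minimum.
  4E<3scc⇒frumious : ∀ {s} → IsScc G s → 4 * #E < 3 * s → Frumious G
  4E<3scc⇒frumious (_ , minimal) 4E<3s M M-perfect (t , classI) =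
    let 𝒞 , cover , tight = factorisation⇒tightCover M-perfect
          (MatchingCopies.classI⇒factorisation G cubic 0<V t M M-perfect classI)
    in <⇒≱ 4E<3s (≤-trans (*-monoʳ-≤ 3 (minimal _ (𝒞 , cover , refl))) (≤-reflexive tight))

  -- No matching can be read off from `¬ Frumious G`. It does refute `4 * #E < 3 * s`, and for
  -- natural numbers this gives the reverse inequality.
  ¬frumious⇒4E≡3scc : ∀ {s} → IsScc G s → ¬ Frumious G → 4 * #E ≡ 3 * s
  ¬frumious⇒4E≡3scc scc ¬frumious = ≤-antisym (4E≤3scc scc) (≮⇒≥ (¬frumious ∘ 4E<3scc⇒frumious scc))

-- Translation to rational numbers

open ℤ using (+_)
open ℚᵘ using (_/_; _>_; _≃_; *≡*; *<*)

-- Unnormalised rationals are compared by cross-multiplication; this lemma and `numerator-3s`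
-- simplify the two sides.
numerator-4E/3 : ∀ E → (+ 4 ℤ.* + E) ℤ.* + 1 ≡ + (4 * E)
numerator-4E/3 E = trans (ℤP.*-identityʳ (+ 4 ℤ.* + E)) (sym (ℤP.pos-* 4 E))

numerator-3s : ∀ s → + s ℤ.* + 3 ≡ + (3 * s)
numerator-3s s = trans (sym (ℤP.pos-* s 3)) (cong +_ (*-comm s 3))

theorem5p4 : (G : Multigraph) → Bridgeless G → Cubic G →
    ∃[ scc ] (IsScc G scc
    × ((+ scc / 1 > (+ 4 / 3) ℚᵘ.* (+ Multigraph.#E G / 1)) ⇔ Frumious G)
    × (¬ Frumious G → + scc / 1 ≃ (+ 4 / 3) ℚᵘ.* (+ Multigraph.#E G / 1)))
theorem5p4 G bridgeless cubic with s , scc ← Covers.scc-exists G bridgeless =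
  s , scc ,
  mk⇔ (λ { (*<* lt) → 4E<3scc⇒frumious scc (ℤP.drop‿+<+ (subst₂ ℤ._<_ (numerator-4E/3 #E) (numerator-3s s) lt)) })
      (λ frumious → *<* (subst₂ ℤ._<_ (sym (numerator-4E/3 #E)) (sym (numerator-3s s))
                          (ℤ.+<+ (frumious⇒4E<3scc scc frumious)))) ,
  λ ¬frumious → *≡* (trans (numerator-3s s)
                  (trans (cong +_ (sym (¬frumious⇒4E≡3scc scc ¬frumious))) (sym (numerator-4E/3 #E))))
  where
  open Multigraph G
  open SccBounds G bridgeless cubic
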